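{- Let $d \ge 11$ be an integer. There exists no balanced sequence $\mathbf{v}$ over an alphabet of $d$ letters whose critical exponent satisfies $\mathrm{E}(\mathbf{v}) < \frac{d-1}{d-2}$.
   Context: A sequence $\mathbf{v}$ over a finite alphabet $\mathcal A$ is balanced if for every letter $a\in\mathcal A$ and every two factors $u,v$ of $\mathbf{v}$ with $|u|=|v|$ we have $|u|_a-|v|_a\le 1$ (where $|u|_a$ is the number of occurrences of $a$ in $u$). For a nonempty finite word $z$, let $u$ be the shortest word such that $z$ is a prefix of $uuu\cdots$; the exponent of $z$ is $\exp(z)=|z|/|u|$. The critical exponent of a sequence $\mathbf{v}$ is $\mathrm{E}(\mathbf{v})=\sup\{\exp(z): z \text{ a nonempty factor of } \mathbf{v}\}$. -}

module Defs where

open import Data.Nat using (ℕ; zero; suc; _+_; _*_; _≤_; _<_)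
open import Data.Nat.DivMod using (_mod_)
open import Data.Fin using (Fin; toℕ)
open import Data.Fin.Properties using (_≟_)
open import Data.Product using (Σ; _×_; ∃-syntax)
open import Relation.Nullary using (¬_; yes; no)
open import Relation.Binary.PropositionalEquality using (_≡_)

Seq : ℕ → Set
Seq d = ℕ → Fin d

Word : Set → ℕ → Set
Word A n = Fin n → A

factor : ∀ {d} → Seq d → ℕ → (n : ℕ) → Word (Fin d) n
factor v i n k = v (i + toℕ k)

count : ∀ {d} → Seq d → Fin d → ℕ → ℕ → ℕ
count v a i zero = 0
count v a i (suc n) with v i ≟ a
... | yes _ = suc (count v a (suc i) n)
... | no  _ = count v a (suc i) n

Balanced : ∀ {d} → Seq d → Set
Balanced {d} v = ∀ (a : Fin d) (i j n : ℕ) → count v a i n ≤ count v a j n + 1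

PrefixOfPower : ∀ {A : Set} {n} → Word A n → (q : ℕ) → Word A (suc q) → Set
PrefixOfPower {n = n} z q u = ∀ (k : Fin n) → z k ≡ u (toℕ k mod suc q)

HasRootOfLength : ∀ {A : Set} {n} → Word A n → ℕ → Set
HasRootOfLength {A} z q = Σ (Word A (suc q)) (PrefixOfPower z q)

ShortestRoot : ∀ {A : Set} {n} → Word A n → ℕ → Set
ShortestRoot z q = HasRootOfLength z q × (∀ q' → q' < q → ¬ HasRootOfLength z q')

ExpAtMost : ∀ {A : Set} {n} → Word A n → ℕ → ℕ → Set
ExpAtMost {n = n} z a b = ∀ q → ShortestRoot z q → n * b ≤ a * suc q

-- E(v) < r / s  (r, s given as naturals, s > 0), i.e.
-- there is a rational a/b < r/s bounding exp(z) for every nonempty factor z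
-- (equivalently the supremum is < r/s).
CritExpLess : ∀ {d} → Seq d → ℕ → ℕ → Set
CritExpLess v r s =
  ∃[ a ] ∃[ b ] (0 < b × a * s < r * b ×
    (∀ (i n : ℕ) → ExpAtMost (factor v i (suc n)) a b))

{-# OPTIONS --safe #-}
-- A small critical exponent makes any d - 1 consecutive letters distinct, so each letter was
-- last seen d - 1, d or d + 1 positions earlier (Short, Middle, Long; a Pansiot coding), and the
-- short repetitions excluded force the pattern of kinds to be a concatenation of blocks Short Long
-- and Short Long Middle. Balance forbids a letter to be both Short and Long. Hence a Middle
-- position recurs after d - 1 or d + 1 steps, according to its letter being otherwise Long or
-- Short. A recurrence moving forward relative to d cannot precede one moving backward, since they
-- would meet, so from some point on all recur with the same step. The pattern is then eventually
-- periodic, and therefore so is the sequence, whose critical exponent would be infinite.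
module Submission where

open import Defs
open import Data.Nat using
  (ℕ; zero; suc; _+_; _*_; _^_; _∸_; _≤_; _<_; _⊔_; z≤n; s≤s; s≤s⁻¹; NonZero; ≢-nonZero⁻¹)
open import Data.Nat.Properties hiding (_≟_)
open import Data.Nat.DivMod using
  (_/_; _%_; m≡m%n+[m/n]*n; m%n<n; m<n⇒m%n≡m; [m+n]%n≡m%n; /-monoˡ-≤; m*n/n≡m)
open import Data.Nat.Tactic.RingSolver using (solve-∀)
open import Data.Nat.Induction using (<-rec)
open import Data.Fin as Fin using (Fin; toℕ; fromℕ<; punchOut; finToFun; funToFin)
import Data.Fin.Properties as Fin
open import Data.Fin.Properties using
  (_≟_; toℕ<n; toℕ-fromℕ<; punchOut-injective; pigeonhole; finToFun-funToFin)
open import Data.Product using (∃-syntax; _×_; _,_)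
open import Data.Sum using (_⊎_; inj₁; inj₂)
open import Data.Empty using (⊥; ⊥-elim)
open import Function using (_∘_; Injective)
open import Relation.Nullary using (¬_; yes; no; contradiction)
open import Relation.Nullary.Decidable using (¬¬-excluded-middle)
open import Relation.Binary.Definitions using (tri<; tri≈; tri>)
open import Relation.Binary.PropositionalEquality

-- Roots, repetitions and the critical exponent.

-- Having a root is not assumed decidable, so the minimum exists only up to double negation; that
-- suffices for refuting an inequality.
¬¬-shortestRoot : ∀ {A : Set} {n} (z : Word A n) q → HasRootOfLength z q →
                  ¬ ¬ (∃[ q' ] (q' ≤ q × ShortestRoot z q'))
¬¬-shortestRoot z = <-rec _ λ q rec root none →
  none (q , ≤-refl , root , λ q' q'<q root' →
    rec q'<q root' λ (q″ , q″≤q' , shortest) →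
      none (q″ , ≤-trans q″≤q' (<⇒≤ q'<q) , shortest))

-- The offset `k` stands on the left so that numeral offsets reduce by computation.
Repeats : ∀ {d} → Seq d → (i p l : ℕ) → Set
Repeats v i p l = ∀ k → k < l → v (k + i) ≡ v (k + (i + p))

repeats⇒root : ∀ {d} (v : Seq d) i q l → Repeats v i (suc q) l →
               HasRootOfLength (factor v i (l + suc q)) q
repeats⇒root v i q l rep = factor v i p , λ k →
  trans (reduce (toℕ k) (toℕ<n k))
        (cong (v ∘ (i +_)) (sym (toℕ-fromℕ< (m%n<n (toℕ k) p))))
  where
  p = suc q
  reduce : ∀ k → k < l + p → v (i + k) ≡ v (i + k % p)
  reduce = <-rec _ step
    where
    step : ∀ k → (∀ {j} → j < k → j < l + p → v (i + j) ≡ v (i + j % p)) →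
           k < l + p → v (i + k) ≡ v (i + k % p)
    step k rec k<l+p with <-≤-connex k p
    ... | inj₁ k<p = cong (v ∘ (i +_)) (sym (m<n⇒m%n≡m k<p))
    ... | inj₂ p≤k = begin
      v (i + k)              ≡⟨ cong v shift ⟩
      v (k ∸ p + (i + p))    ≡⟨ rep (k ∸ p) k∸p<l ⟨
      v (k ∸ p + i)          ≡⟨ cong v (+-comm (k ∸ p) i) ⟩
      v (i + (k ∸ p))        ≡⟨ rec (∸-monoʳ-< {k} (s≤s z≤n) p≤k) (<-≤-trans k∸p<l (m≤m+n l p)) ⟩
      v (i + (k ∸ p) % p)    ≡⟨ cong (v ∘ (i +_))
        (trans (sym ([m+n]%n≡m%n (k ∸ p) p)) (cong (_% p) (m∸n+n≡m p≤k))) ⟩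
      v (i + k % p)          ∎
      where
      open ≡-Reasoning
      k∸p<l : k ∸ p < l
      k∸p<l = +-cancelʳ-< p (k ∸ p) l (subst (_< l + p) (sym (m∸n+n≡m p≤k)) k<l+p)
      shift : i + k ≡ k ∸ p + (i + p)
      shift = trans (cong (i +_) (trans (sym (m∸n+n≡m p≤k)) (+-comm (k ∸ p) p)))
                    (trans (sym (+-assoc i p (k ∸ p))) (+-comm (i + p) (k ∸ p)))

-- A repetition of length l at distance p is a factor with exponent at least (l + p) / p.
repeats⇒long-period : ∀ {d} (v : Seq d) s → CritExpLess v (suc s) s →
  ∀ i p l → 0 < p → Repeats v i p l → l * s < p
repeats⇒long-period v s (a , b , 0<b , as<rb , bound) i p@(suc q) l 0<p rep =
  ≰⇒> λ p≤ls → ¬¬-shortestRoot z q root λ (q' , q'≤q , shortest) →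
    <-irrefl refl (begin-strict
      (l + p) * b * s       ≤⟨ *-monoˡ-≤ s (long shortest) ⟩
      a * suc q' * s        ≤⟨ *-monoˡ-≤ s (*-monoʳ-≤ a (s≤s q'≤q)) ⟩
      a * p * s             ≡⟨ swapʳ a p s ⟩
      a * s * p             <⟨ *-monoˡ-< p as<rb ⟩
      suc s * b * p         ≡⟨ swapʳ (suc s) b p ⟩
      suc s * p * b         ≤⟨ *-monoˡ-≤ b (+-monoˡ-≤ (s * p) p≤ls) ⟩
      (l * s + s * p) * b   ≡⟨ cong (λ x → (l * s + x) * b) (*-comm s p) ⟩
      (l * s + p * s) * b   ≡⟨ cong (_* b) (*-distribʳ-+ s l p) ⟨
      (l + p) * s * b       ≡⟨ swapʳ (l + p) s b ⟩
      (l + p) * b * s       ∎)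
  where
  open ≤-Reasoning
  z = factor v i (l + p)
  root = repeats⇒root v i q l rep
  swapʳ : ∀ x y w → x * y * w ≡ x * w * y
  swapʳ x y w = trans (*-assoc x y w) (trans (cong (x *_) (*-comm y w)) (sym (*-assoc x w y)))
  long : ∀ {q'} → ShortestRoot z q' → (l + p) * b ≤ a * suc q'
  -- `bound` speaks only of lengths in successor form.
  long {q'} rewrite +-suc l q = bound i (l + q) q'

-- Letter counts, missing values and eventual periodicity.

count≡0 : ∀ {d} (v : Seq d) a i n → (∀ k → k < n → v (k + i) ≢ a) → count v a i n ≡ 0
count≡0 v a i zero    absent = refl
count≡0 v a i (suc n) absent with v i ≟ a
... | yes vi≡a = contradiction vi≡a (absent 0 (s≤s z≤n))
... | no  _    = count≡0 v a (suc i) n λ k k<n →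
  absent (suc k) (s≤s k<n) ∘ trans (cong v (sym (+-suc k i)))

count≥1 : ∀ {d} (v : Seq d) a i n → v (n + i) ≡ a → 1 ≤ count v a i (suc n)
count≥1 v a i n vn≡a with v i ≟ a
count≥1 v a i n       vn≡a | yes _    = s≤s z≤n
count≥1 v a i zero    vn≡a | no  vi≢a = contradiction vn≡a vi≢a
count≥1 v a i (suc n) vn≡a | no  _    = count≥1 v a (suc i) n (trans (cong v (+-suc n i)) vn≡a)

count≥2 : ∀ {d} (v : Seq d) a i n → v i ≡ a → v (suc n + i) ≡ a → 2 ≤ count v a i (2 + n)
count≥2 v a i n vi≡a vn≡a with v i ≟ a
... | yes _    = s≤s (count≥1 v a (suc i) n (trans (cong v (+-suc n i)) vn≡a))
... | no  vi≢a = contradiction vi≡a vi≢a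

-- If `x` and `y` differed, `y` and the `k` values of `f` would be `suc k` distinct elements
-- avoiding `x`; punching out `x` squeezes them into `Fin k`.
injective⇒missing-unique : ∀ {k} (f : Fin k → Fin (suc k)) → Injective _≡_ _≡_ f →
  ∀ {x y} → (∀ j → x ≢ f j) → (∀ j → y ≢ f j) → x ≡ y
injective⇒missing-unique {k} f inj {x} {y} x∉ y∉ with x ≟ y
... | yes x≡y = x≡y
... | no  x≢y =
  let i , j , i<j , eq = pigeonhole (n<1+n k) (λ j → punchOut (x≢ j))
  in ⊥-elim (collide i j i<j (punchOut-injective (x≢ i) (x≢ j) eq))
  where
  y∷f : Fin (suc k) → Fin (suc k)
  y∷f Fin.zero    = y
  y∷f (Fin.suc j) = f j
  x≢ : ∀ j → x ≢ y∷f j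
  x≢ Fin.zero    = x≢y
  x≢ (Fin.suc j) = x∉ j
  collide : ∀ i j → i Fin.< j → y∷f i ≢ y∷f j
  collide Fin.zero    (Fin.suc j) _   eq = y∉ j eq
  collide (Fin.suc i) (Fin.suc j) i<j eq = Fin.<⇒≢ i<j (cong Fin.suc (inj eq))

-- On each residue class mod e a predicate closed under +e is eventually constant.
¬¬-eventually-periodic : (P : ℕ → Set) (e : ℕ) .{{_ : NonZero e}} →
  (∀ t → P t → P (t + e)) → ¬ ¬ (∃[ N ] (∀ t → N ≤ t → P (t + e) → P t))
¬¬-eventually-periodic P e closed none = residues e λ (K , stable) →
  none (K * e , λ t Ke≤t Pt+e →
    let t≡ = m≡m%n+[m/n]*n t e
        K≤ = subst (_≤ t / e) (m*n/n≡m K e) (/-monoˡ-≤ e Ke≤t)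
    in subst P (sym t≡) (stable (t % e) (m%n<n t e) (t / e) K≤ (subst (λ x → P (x + e)) t≡ Pt+e)))
  where
  Stable : ℕ → ℕ → Set
  Stable K r = ∀ k → K ≤ k → P (r + k * e + e) → P (r + k * e)

  advance : ∀ r j k → P (r + k * e) → P (r + (j + k) * e)
  advance r zero    k p = p
  advance r (suc j) k p =
    subst P (trans (+-assoc r _ e) (cong (r +_) (+-comm _ e))) (closed _ (advance r j k p))

  -- Either `P` holds somewhere on the class, hence from there on, or nowhere, and the implication
  -- is vacuous. As `P` is arbitrary, this choice is made under a double negation.
  residue : ∀ r → ¬ ¬ (∃[ K ] Stable K r)
  residue r none = ¬¬-excluded-middle {A = ∃[ k ] P (r + k * e)} λ
    { (yes (K , p)) → none (K , λ k K≤k _ →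
        subst (λ x → P (r + x * e)) (m∸n+n≡m K≤k) (advance r (k ∸ K) K p))
    ; (no never) → none (0 , λ k _ p → contradiction
        (suc k , subst P (trans (+-assoc r _ e) (cong (r +_) (+-comm _ e))) p) never) }

  residues : ∀ b → ¬ ¬ (∃[ K ] (∀ r → r < b → Stable K r))
  residues zero    none = none (0 , λ _ ())
  residues (suc b) none = residues b λ (K , stable) → residue b λ (K' , stable') →
    none (K ⊔ K' , λ r r<1+b k K⊔K'≤k → case-≤ r<1+b stable stable' k K⊔K'≤k)
    where
    case-≤ : ∀ {K K' r} → r < suc b → (∀ r → r < b → Stable K r) → Stable K' b → Stable (K ⊔ K') r
    case-≤ {K} {K'} r<1+b stable stable' k ≤k with m<1+n⇒m<n∨m≡n r<1+b
    ... | inj₁ r<b  = stable _ r<b k (≤-trans (m≤m⊔n K K') ≤k)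
    ... | inj₂ refl = stable' k (≤-trans (m≤n⊔m K K') ≤k)

-- The coding of the sequence by kinds of position.

module _ (m : ℕ) (3≤m : 3 ≤ m) (v : Seq (2 + m)) (balanced : Balanced v)
         (small : CritExpLess v (1 + m) m) where

  -- With d = `2 + m` letters, `n` is d - 1.
  n = 1 + m

  no-repeat : ∀ i p l → 0 < p → p ≤ l * m → ¬ Repeats v i p l
  no-repeat i p l 0<p p≤lm rep = <⇒≱ (repeats⇒long-period v m small i p l 0<p rep) p≤lm

  -- A repetition of length 2 needs a distance above `2 * m`, and `c ≤ 3 ≤ m`. The values 1, 2, 3 of
  -- `c` give the distances of the three kinds, so no kind occurs twice in a row.
  no-repeat₂ : ∀ i c → c ≤ 3 → v i ≡ v (i + (c + m)) → v (suc i) ≢ v (suc i + (c + m))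
  no-repeat₂ i c c≤3 eq₀ eq₁ =
    no-repeat i (c + m) 2 (≤-trans (≤-trans (s≤s z≤n) 3≤m) (m≤n+m m c))
      (≤-trans (+-monoˡ-≤ m (≤-trans c≤3 3≤m)) (+-monoʳ-≤ m (m≤m+n m 0)))
      λ { 0 _ → eq₀ ; 1 _ → eq₁ ; (suc (suc _)) (s≤s (s≤s ())) }

  distinct : ∀ {i j} → i < j → j ≤ i + m → v i ≢ v j
  distinct {i} {j} i<j j≤i+m vi≡vj =
    no-repeat i (j ∸ i) 1 (m<n⇒0<n∸m i<j)
      (≤-trans (≤-trans (∸-monoˡ-≤ i j≤i+m) (≤-reflexive (m+n∸m≡n i m))) (m≤m+n m 0))
      λ { 0 _ → trans vi≡vj (cong v (sym (m+[n∸m]≡n (<⇒≤ i<j)))) ; (suc _) (s≤s ()) }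

  -- Position i describes the letter v (i + n + 2): its previous occurrence is at distance
  -- d - 1, d or d + 1 if Short i, Middle i or Long i respectively.
  Short Middle Long : ℕ → Set
  Short  i = v (2 + (i + n)) ≡ v (2 + i)
  Middle i = v (2 + (i + n)) ≡ v (1 + i)
  Long   i = v (2 + (i + n)) ≡ v i

  letter : ℕ → Fin (2 + m)
  letter i = v (2 + (i + n))

  adjacent : ∀ i → v i ≢ v (suc i)
  adjacent i = distinct (n<1+n i)
    (≤-trans (≤-reflexive (+-comm 1 i)) (+-monoʳ-≤ i (≤-trans (s≤s z≤n) 3≤m)))

  two-apart : ∀ i → v i ≢ v (2 + i)
  two-apart i = distinct (m≤n⇒m≤1+n (n<1+n i))
    (≤-trans (≤-reflexive (+-comm 2 i)) (+-monoʳ-≤ i (≤-trans (s≤s (s≤s z≤n)) 3≤m)))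

  ¬short-short : ∀ i → Short i → ¬ Short (1 + i)
  ¬short-short i s s' = no-repeat₂ (2 + i) 1 (s≤s z≤n) (sym s) (sym s')

  ¬middle-middle : ∀ i → Middle i → ¬ Middle (1 + i)
  ¬middle-middle i t t' = no-repeat₂ (1 + i) 2 (s≤s (s≤s z≤n))
    (trans (sym t) (cong (v ∘ suc) (sym (+-suc i n))))
    (trans (sym t') (cong (v ∘ (2 +_)) (sym (+-suc i n))))

  ¬long-long : ∀ i → Long i → ¬ Long (1 + i)
  ¬long-long i l l' = no-repeat₂ i 3 ≤-refl
    (trans (sym l) (cong v (sym i+2+n))) (trans (sym l') (cong (v ∘ suc) (sym i+2+n)))
    where
    i+2+n : i + (2 + n) ≡ 2 + (i + n)
    i+2+n = trans (+-suc i (1 + n)) (cong suc (+-suc i n))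

  private module Window (i : ℕ) where
    window : Fin n → Fin (2 + m)
    window j = v (toℕ j + (2 + i))

    last : m + (2 + i) ≡ 1 + (i + n)
    last = trans (+-comm m (2 + i)) (cong suc (sym (+-suc i m)))

    newest-missing : ¬ Short i → ∀ j → v (2 + (i + n)) ≢ window j
    newest-missing ¬s Fin.zero    eq = ¬s eq
    newest-missing ¬s (Fin.suc j) eq = distinct
      (subst (suc (toℕ j) + (2 + i) <_) (+-comm n (2 + i)) (+-monoˡ-< (2 + i) (s≤s (toℕ<n j))))
      (subst (_≤ suc (toℕ j) + (2 + i) + m)
        (cong suc (trans (cong suc (+-comm (1 + i) m)) (cong suc (trans (+-comm m (1 + i)) (sym (+-suc i m))))))
        (+-monoˡ-≤ m (s≤s (m≤n+m (2 + i) (toℕ j)))))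
      (sym eq)

    missing-unique : ∀ {x y} → (∀ j → x ≢ window j) → (∀ j → y ≢ window j) → x ≡ y
    missing-unique = injective⇒missing-unique window λ {j} {k} → injective j k
      where
      increasing : ∀ {j k} → toℕ j < toℕ k → window j ≢ window k
      increasing {j} {k} j<k = distinct (+-monoˡ-< (2 + i) j<k)
        (≤-trans (≤-trans (+-monoˡ-≤ (2 + i) (s≤s⁻¹ (toℕ<n k))) (≤-reflexive (+-comm m (2 + i))))
          (+-monoˡ-≤ m (m≤n+m (2 + i) (toℕ j))))
      injective : ∀ j k → window j ≡ window k → j ≡ k
      injective j k eq with <-cmp (toℕ j) (toℕ k)
      ... | tri< j<k _ _ = contradiction eq (increasing j<k)
      ... | tri≈ _ j≡k _ = Fin.toℕ-injective j≡k
      ... | tri> _ _ k<j = contradiction (sym eq) (increasing k<j)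

  -- The n letters before position i + n + 2 are distinct, so only one letter is missing there.
  trichotomy : ∀ i → Short i ⊎ Middle i ⊎ Long i
  -- The second test asks whether `v (1 + i)` has already recurred just before the new position. If
  -- not, it is the missing letter; if so, `v i` is.
  trichotomy i with v (2 + (i + n)) ≟ v (2 + i) | v (1 + i) ≟ v (1 + (i + n))
  ... | yes s  | _      = inj₁ s
  ... | no  ¬s | no ¬s' = inj₂ (inj₁ (missing-unique (newest-missing ¬s) middle-missing))
    where
    open Window i
    middle-missing : ∀ j → v (1 + i) ≢ window j
    middle-missing j eq with m<1+n⇒m<n∨m≡n (toℕ<n j)
    ... | inj₁ j<m = distinct (m≤n+m (2 + i) (toℕ j))
      (subst₂ _≤_ (sym (+-suc (toℕ j) (1 + i))) (+-comm m (1 + i)) (+-monoˡ-≤ (1 + i) j<m)) eq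
    ... | inj₂ j≡m = ¬s' (trans eq (cong v (trans (cong (_+ (2 + i)) j≡m) last)))
  ... | no  ¬s | yes s' = inj₂ (inj₂ (missing-unique (newest-missing ¬s) long-missing))
    where
    open Window i
    long-missing : ∀ j → v i ≢ window j
    long-missing j eq with m≤n⇒m<n∨m≡n (s≤s⁻¹ (toℕ<n j))
    ... | inj₂ j≡m = adjacent i (trans eq (trans (cong v (trans (cong (_+ (2 + i)) j≡m) last)) (sym s')))
    ... | inj₁ j<m with m≤n⇒m<n∨m≡n j<m
    ...   | inj₁ 1+j<m = distinct (≤-trans (m≤n⇒m≤1+n ≤-refl) (m≤n+m (2 + i) (toℕ j)))
                           (subst₂ _≤_ (sym (trans (+-suc (toℕ j) (1 + i)) (cong suc (+-suc (toℕ j) i))))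
                             (+-comm m i) (+-monoˡ-≤ i 1+j<m)) eq
    -- Here `v i` and `v (1 + i)` would both recur at distance `n`.
    ...   | inj₂ 1+j≡m = no-repeat₂ i 1 (s≤s z≤n)
                           (trans eq (cong v (suc-injective (trans (cong (_+ (2 + i)) 1+j≡m) last))))
                           s'

  -- Short followed by Middle would place one letter at two adjacent positions; Middle followed by
  -- Long is excluded below in the same way.
  Short⇒Long : ∀ {i} → Short i → Long (1 + i)
  Short⇒Long {i} s with trichotomy (1 + i)
  ... | inj₁ s'        = contradiction s' (¬short-short i s)
  ... | inj₂ (inj₁ t') = contradiction (trans s (sym t')) (adjacent _)
  ... | inj₂ (inj₂ l') = l'

  Middle⇒Short : ∀ {i} → Middle i → Short (1 + i)
  Middle⇒Short {i} t with trichotomy (1 + i)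
  ... | inj₁ s'        = s'
  ... | inj₂ (inj₁ t') = contradiction t' (¬middle-middle i t)
  ... | inj₂ (inj₂ l') = contradiction (trans t (sym l')) (adjacent _)

  Long⇒Short⊎Middle : ∀ {i} → Long i → Short (1 + i) ⊎ Middle (1 + i)
  Long⇒Short⊎Middle {i} l with trichotomy (1 + i)
  ... | inj₁ s'        = inj₁ s'
  ... | inj₂ (inj₁ t') = inj₂ t'
  ... | inj₂ (inj₂ l') = contradiction l' (¬long-long i l)

  ¬Short×Middle : ∀ {i} → Short i → ¬ Middle i
  ¬Short×Middle s t = adjacent _ (trans (sym t) s)

  ¬Short×Long : ∀ {i} → Short i → ¬ Long i
  ¬Short×Long s l = two-apart _ (trans (sym l) s)

  ¬Middle×Long : ∀ {i} → Middle i → ¬ Long i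
  ¬Middle×Long t l = adjacent _ (trans (sym l) t)

  Middle⇒Long-before : ∀ {i} → Middle (1 + i) → Long i
  Middle⇒Long-before {i} t' with trichotomy i
  ... | inj₁ s        = contradiction (Short⇒Long s) (¬Middle×Long t')
  ... | inj₂ (inj₁ t) = contradiction t' (¬middle-middle i t)
  ... | inj₂ (inj₂ l) = l

  Long⇒Short-before : ∀ {i} → Long (1 + i) → Short i
  Long⇒Short-before {i} l' with trichotomy i
  ... | inj₁ s        = s
  ... | inj₂ (inj₁ t) = contradiction l' (¬Short×Long (Middle⇒Short t))
  ... | inj₂ (inj₂ l) = contradiction l' (¬long-long i l)

  Short⇒Long⊎Middle-before : ∀ {i} → Short (1 + i) → Long i ⊎ Middle i
  Short⇒Long⊎Middle-before {i} s' with trichotomy i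
  ... | inj₁ s        = contradiction s' (¬short-short i s)
  ... | inj₂ (inj₁ t) = inj₂ t
  ... | inj₂ (inj₂ l) = inj₁ l

  -- d consecutive positions may contain a letter twice or not at all, but by balance not both.
  short≢long : ∀ {i j} → Short i → Long j → letter i ≢ letter j
  short≢long {i} {j} s l eq = <⇒≱ (s≤s (s≤s z≤n)) (begin
    2                                         ≤⟨ count≥2 v (letter i) (2 + i) m (sym s) (cong v (+-comm n (2 + i))) ⟩
    count v (letter i) (2 + i) (2 + m)        ≤⟨ balanced (letter i) (2 + i) (1 + j) (2 + m) ⟩
    count v (letter i) (1 + j) (2 + m) + 1    ≡⟨ cong (_+ 1) (count≡0 v (letter i) (1 + j) (2 + m) absent) ⟩
    1                                         ∎)
    where
    open ≤-Reasoning
    absent : ∀ k → k < 2 + m → v (k + (1 + j)) ≢ letter i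
    absent k k<2+m rewrite eq with <-≤-connex k m
    -- The first `m` positions are too close to the occurrence at `j`, the others to the one at
    -- `2 + (j + n)`.
    ... | inj₁ k<m = distinct (m≤n+m (1 + j) k)
      (subst₂ _≤_ (sym (+-suc k j)) (+-comm m j) (+-monoˡ-≤ j k<m)) ∘ sym ∘ λ eq' → trans eq' l
    ... | inj₂ m≤k = distinct {k + (1 + j)} {2 + (j + n)}
      (subst (k + (1 + j) <_)
        (cong suc (trans (cong suc (+-comm m (1 + j))) (cong suc (sym (+-suc j m))))) (+-monoˡ-< (1 + j) k<2+m))
      (begin
        2 + (j + n)          ≡⟨ cong (2 +_) (+-comm j n) ⟩
        3 + (m + j)          ≤⟨ +-monoˡ-≤ (m + j) 3≤m ⟩
        m + (m + j)          ≤⟨ +-monoʳ-≤ m (+-mono-≤ m≤k (n≤1+n j)) ⟩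
        m + (k + (1 + j))    ≡⟨ +-comm m _ ⟩
        k + (1 + j) + m      ∎)

  -- The motion of the Middle positions.

  -- The witness `j` may lie anywhere. By `short≢long` no position is of both sorts.
  LongMiddle ShortMiddle : ℕ → Set
  LongMiddle  t = Middle t × ∃[ j ] (Long  j × letter j ≡ letter t)
  ShortMiddle t = Middle t × ∃[ j ] (Short j × letter j ≡ letter t)

  -- After d positions a pair Short, Long reappears with its two letters exchanged; this moves
  -- a Middle position by d - 1 or d + 1 according to the kind of its letter.
  middle-step : ∀ {u} → Middle (2 + u) →
    (LongMiddle (2 + (u + n)) × Long (4 + (u + n))) ⊎
    (ShortMiddle (4 + (u + n)) × Short (2 + (u + n)))
  middle-step {u} t = go (trichotomy (3 + (u + n)))
    where
    l₁ : Long (1 + u)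
    l₁ = Middle⇒Long-before t
    s₀ : Short u
    s₀ = Long⇒Short-before l₁
    s₃ : Short (3 + u)
    s₃ = Middle⇒Short t
    l₄ : Long (4 + u)
    l₄ = Short⇒Long s₃
    Result = (LongMiddle (2 + (u + n)) × Long (4 + (u + n))) ⊎
             (ShortMiddle (4 + (u + n)) × Short (2 + (u + n)))
    go : Short (3 + (u + n)) ⊎ Middle (3 + (u + n)) ⊎ Long (3 + (u + n)) → Result
    go (inj₁ s) with Short⇒Long⊎Middle-before s
    -- A Short, Middle or Long position carries the letter of the position d - 1, d or d + 1
    -- earlier; here a Long one would repeat the letter of the Short position `u`.
    ... | inj₁ l' = contradiction (sym l') (short≢long s₀ l')
    ... | inj₂ t' = inj₁ ((t' , 1 + u , l₁ , sym t') , Short⇒Long s)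
    go (inj₂ (inj₁ t')) = contradiction (sym l') (short≢long s₀ l')
      where l' = Middle⇒Long-before t'
    go (inj₂ (inj₂ l)) with Long⇒Short⊎Middle l
    ... | inj₁ s' = contradiction s' (short≢long s' l₄)
    ... | inj₂ t' = inj₂ ((t' , 3 + u , s₃ , sym t') , Long⇒Short-before l)

  -- The second component of `middle-step` is a later position with the letter of the Middle one;
  -- its kind must be compatible with that of `j`, which selects the case.
  longMiddle-step : ∀ {u} → LongMiddle (2 + u) → LongMiddle (2 + (u + n))
  longMiddle-step (t , j , l , eq) with middle-step t
  ... | inj₁ (lm , _) = lm
  ... | inj₂ (_ , s)  = contradiction (trans s (sym eq)) (short≢long s l)

  shortMiddle-step : ∀ {u} → ShortMiddle (2 + u) → ShortMiddle (4 + (u + n))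
  shortMiddle-step (t , j , s , eq) with middle-step t
  ... | inj₁ (_ , l)  = contradiction (trans eq (sym l)) (short≢long s l)
  ... | inj₂ (sm , _) = sm

  -- The two positions approach each other by 2 in every round and cannot pass.
  no-crossing : ∀ k s → ShortMiddle (2 + s) → ¬ LongMiddle (k + (2 + s))
  no-crossing 0 s (_ , _ , s' , eq) (_ , _ , l' , eq') = short≢long s' l' (trans eq (sym eq'))
  no-crossing 1 s (t , _) (t' , _) = ¬middle-middle (2 + s) t t'
  no-crossing (suc (suc k)) s sm lm =
    no-crossing k (2 + (s + n)) (shortMiddle-step sm)
      (subst LongMiddle
        (trans (cong (2 +_) (+-assoc k (2 + s) n)) (sym (trans (+-suc k _) (cong suc (+-suc k _)))))
        (longMiddle-step lm))

  -- From periodic Middle positions to a periodic sequence.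

  -- The `3 + n` letters from `i` on end with `letter i`, so agreement fixes the kind of position
  -- `i`.
  Agree : ℕ → ℕ → Set
  Agree i i' = ∀ k → k < 3 + n → v (k + i) ≡ v (k + i')

  agree-letter : ∀ {i i'} → Agree i i' → letter i ≡ letter i'
  agree-letter {i} {i'} agree = begin
    letter i        ≡⟨ cong (v ∘ (2 +_)) (+-comm i n) ⟩
    v (2 + n + i)   ≡⟨ agree (2 + n) ≤-refl ⟩
    v (2 + n + i')  ≡⟨ cong (v ∘ (2 +_)) (+-comm n i') ⟩
    letter i'       ∎
    where open ≡-Reasoning

  -- The kind of `i` forces that of `1 + i`, except after Long, where Short and Middle are both
  -- open; the two hypotheses on Middle settle that choice.
  next-letter : ∀ {i i'} → Agree i i' → (Middle (1 + i) → Middle (1 + i')) →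
                (Middle (1 + i') → Middle (1 + i)) → letter (1 + i) ≡ letter (1 + i')
  next-letter {i} {i'} agree to from = go (trichotomy i)
    where
    at : ∀ k → k ≤ 3 → v (k + i) ≡ v (k + i')
    at k k≤3 = agree k (≤-trans (s≤s k≤3) (+-monoʳ-≤ 3 (s≤s z≤n)))
    at₁ = at 1 (s≤s z≤n)
    at₂ = at 2 (s≤s (s≤s z≤n))
    at₃ = at 3 ≤-refl
    copy : ∀ {k} → k ≤ 3 → letter i ≡ v (k + i) → letter i' ≡ v (k + i')
    copy k≤3 eq = trans (sym (agree-letter agree)) (trans eq (at _ k≤3))
    go : Short i ⊎ Middle i ⊎ Long i → letter (1 + i) ≡ letter (1 + i')
    go (inj₁ s) = trans (Short⇒Long s) (trans at₁ (sym (Short⇒Long (copy {2} (s≤s (s≤s z≤n)) s))))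
    go (inj₂ (inj₁ t)) = trans (Middle⇒Short t) (trans at₃ (sym (Middle⇒Short (copy {1} (s≤s z≤n) t))))
    go (inj₂ (inj₂ l)) with Long⇒Short⊎Middle l | Long⇒Short⊎Middle (copy {0} z≤n l)
    ... | inj₁ s | inj₁ s' = trans s (trans at₃ (sym s'))
    ... | inj₂ t | inj₂ t' = trans t (trans at₂ (sym t'))
    ... | inj₁ s | inj₂ t' = contradiction (from t') (¬Short×Middle s)
    ... | inj₂ t | inj₁ s' = contradiction (to t) (¬Short×Middle s')

  agree-step : ∀ {i i'} → Agree i i' → (Middle (1 + i) → Middle (1 + i')) →
               (Middle (1 + i') → Middle (1 + i)) → Agree (1 + i) (1 + i')
  agree-step {i} {i'} agree to from k k<3+n with m<1+n⇒m<n∨m≡n k<3+n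
  ... | inj₁ k<2+n = trans (cong v (+-suc k i)) (trans (agree (suc k) (s≤s k<2+n))
      (cong v (sym (+-suc k i'))))
  ... | inj₂ refl  = trans (last i) (trans (next-letter agree to from) (sym (last i')))
    where
    last : ∀ i → v (2 + n + (1 + i)) ≡ letter (1 + i)
    last i = cong (v ∘ (2 +_)) (+-comm n (1 + i))

  -- Agreement propagates forever, and a repetition of length `p` at distance `p` is a square.
  ¬Agree : ∀ i p → 0 < p →
    (∀ t → i ≤ t → Middle t → Middle (t + p)) →
    (∀ t → i ≤ t → Middle (t + p) → Middle t) → ¬ Agree i (i + p)
  ¬Agree i p 0<p to from agree =
    no-repeat i p p 0<p (subst (_≤ p * m) (*-identityʳ p) (*-monoʳ-≤ p (≤-trans (s≤s z≤n) 3≤m)))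
      λ k _ → later k 0 (s≤s z≤n)
    where
    later : ∀ k → Agree (k + i) (k + (i + p))
    later zero    = agree
    later (suc k) = agree-step (later k)
      (subst Middle (cong suc (+-assoc k i p)) ∘ to (suc (k + i)) (m≤n⇒m≤1+n (m≤n+m i k)))
      (from (suc (k + i)) (m≤n⇒m≤1+n (m≤n+m i k)) ∘ subst Middle (cong suc (sym (+-assoc k i p))))

  -- Among the windows at `N + k * e` two agree, since there are only `(2 + m) ^ (3 + n)` of them;
  -- their distance is a multiple of `e`, which preserves the Middle positions.
  ¬periodic-middles : ∀ N e → 0 < e →
    (∀ t → N ≤ t → Middle t → Middle (t + e)) →
    ¬ (∀ t → N ≤ t → Middle (t + e) → Middle t)
  ¬periodic-middles N e 0<e to from
    with k , k' , k<k' , eq ← pigeonhole (n<1+n ((2 + m) ^ (3 + n)))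
           (λ k → funToFin (λ (j : Fin (3 + n)) → v (toℕ j + (N + toℕ k * e)))) =
    ¬Agree i (c * e) (*-mono-≤ (m<n⇒0<n∸m k<k') 0<e)
      (λ t i≤t → toⁿ c t (≤-trans N≤i i≤t))
      (λ t i≤t → fromⁿ c t (≤-trans N≤i i≤t)) agree
    where
    i = N + toℕ k * e
    c = toℕ k' ∸ toℕ k
    N≤i = m≤m+n N (toℕ k * e)
    i+ce : N + toℕ k' * e ≡ i + c * e
    i+ce = begin
      N + toℕ k' * e             ≡⟨ cong (λ x → N + x * e) (m+[n∸m]≡n (<⇒≤ k<k')) ⟨
      N + (toℕ k + c) * e        ≡⟨ cong (N +_) (*-distribʳ-+ e (toℕ k) c) ⟩
      N + (toℕ k * e + c * e)    ≡⟨ +-assoc N _ _ ⟨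
      i + c * e                  ∎
      where open ≡-Reasoning
    window : ℕ → Fin (3 + n) → Fin (2 + m)
    window i j = v (toℕ j + i)
    agree : Agree i (i + c * e)
    agree k₀ k₀<3+n = begin
      v (k₀ + i)                                      ≡⟨ at i ⟩
      window i j                                      ≡⟨ finToFun-funToFin (window i) j ⟨
      finToFun (funToFin (window i)) j                ≡⟨ cong (λ x → finToFun x j) eq ⟩
      finToFun (funToFin (window (N + toℕ k' * e))) j ≡⟨ finToFun-funToFin (window (N + toℕ k' * e)) j ⟩
      window (N + toℕ k' * e) j                       ≡⟨ cong (λ i → window i j) i+ce ⟩
      window (i + c * e) j                            ≡⟨ at (i + c * e) ⟨
      v (k₀ + (i + c * e))                            ∎
      where
      open ≡-Reasoning
      j = fromℕ< k₀<3+n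
      at : ∀ i → v (k₀ + i) ≡ window i j
      at i = cong (λ x → v (x + i)) (sym (toℕ-fromℕ< k₀<3+n))
    toⁿ : ∀ c t → N ≤ t → Middle t → Middle (t + c * e)
    toⁿ zero    t N≤t = subst Middle (sym (+-identityʳ t))
    toⁿ (suc c) t N≤t =
      subst Middle (+-assoc t e (c * e)) ∘ toⁿ c (t + e) (≤-trans N≤t (m≤m+n t e)) ∘ to t N≤t
    fromⁿ : ∀ c t → N ≤ t → Middle (t + c * e) → Middle t
    fromⁿ zero    t N≤t = subst Middle (+-identityʳ t)
    fromⁿ (suc c) t N≤t =
      from t N≤t ∘ fromⁿ c (t + e) (≤-trans N≤t (m≤m+n t e)) ∘ subst Middle (sym (+-assoc t e (c * e)))

  -- Closure in one direction suffices, as `¬¬-eventually-periodic` supplies the converse from some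
  -- point on; the shift by `N` makes closure start at 0.
  ¬closed-middles : ∀ N e .{{_ : NonZero e}} → ¬ (∀ t → Middle (t + N) → Middle (t + e + N))
  ¬closed-middles N e closed =
    ¬¬-eventually-periodic (λ t → Middle (t + N)) e closed λ (K , stable) →
      ¬periodic-middles (K + N) e (n≢0⇒n>0 (≢-nonZero⁻¹ e))
        (shifted (λ t → Middle t → Middle (t + e)) K
          (λ t _ → subst Middle (swap t) ∘ closed t))
        (shifted (λ t → Middle (t + e) → Middle t) K
          (λ t K≤t → stable t K≤t ∘ subst Middle (sym (swap t))))
    where
    swap : ∀ t → t + e + N ≡ t + N + e
    swap t = trans (+-assoc t e N) (trans (cong (t +_) (+-comm e N)) (sym (+-assoc t N e)))
    shifted : ∀ (P : ℕ → Set) K → (∀ t → K ≤ t → P (t + N)) → ∀ t → K + N ≤ t → P t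
    shifted P K p t K+N≤t = subst P (m∸n+n≡m (m+n≤o⇒n≤o K K+N≤t)) (p (t ∸ N) (m+n≤o⇒m≤o∸n K K+N≤t))

  -- A common step for all late Middle positions.

  impossible : ⊥
  -- The common step is d + 1 = `2 + n` once a ShortMiddle position has occurred, and d - 1 = `n` if
  -- there is none.
  impossible = ¬¬-excluded-middle {A = ∃[ s ] ShortMiddle (2 + s)} λ
    { (yes (s , sm)) → ¬closed-middles (2 + s) (2 + n) λ t → after s sm t
    ; (no ¬sm)       → ¬closed-middles 2 n λ t → without ¬sm t }
    where
    regroup₀ : ∀ t s → t + (2 + s) ≡ 2 + (t + s)
    regroup₀ = solve-∀
    regroup₁ : ∀ t s n → 2 + (t + s + n) ≡ t + n + (2 + s)
    regroup₁ = solve-∀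
    regroup₂ : ∀ t s n → 4 + (t + s + n) ≡ t + (2 + n) + (2 + s)
    regroup₂ = solve-∀
    after : ∀ s → ShortMiddle (2 + s) → ∀ t → Middle (t + (2 + s)) → Middle (t + (2 + n) + (2 + s))
    after s sm t mid with middle-step (subst Middle (regroup₀ t s) mid)
    -- The LongMiddle position would lie `t + n` places after the ShortMiddle one at `2 + s`.
    ... | inj₁ (lm , _)         = contradiction (subst LongMiddle (regroup₁ t s n) lm) (no-crossing (t + n) s sm)
    ... | inj₂ ((mid' , _) , _) = subst Middle (regroup₂ t s n) mid'
    without : ¬ (∃[ s ] ShortMiddle (2 + s)) → ∀ t → Middle (t + 2) → Middle (t + n + 2)
    without ¬sm t mid with middle-step (subst Middle (+-comm t 2) mid)
    ... | inj₁ ((mid' , _) , _) = subst Middle (+-comm 2 (t + n)) mid'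
    ... | inj₂ (sm , _)        = contradiction (_ , sm) ¬sm

theorem3 : ∀ (d : ℕ) → 11 ≤ d → (v : Seq d) → Balanced v → ¬ CritExpLess v (d ∸ 1) (d ∸ 2)
theorem3 (suc (suc m)) 11≤d v = impossible m (≤-trans (s≤s (s≤s (s≤s z≤n))) (s≤s⁻¹ (s≤s⁻¹ 11≤d))) v
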